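{- Let $(H,f)$ be a vertex-weighted graph with $H$ connected and $f$ not identically zero, and let $G=L(H,f)$. If $k(G)=1$, then at least one of the following holds: (i) $f(v)=1$ for some vertex $v$ of $H$; (ii) there exists a vertex $v$ of $H$ with $f(v)=0$ such that $K_H(v)$ contains a simplicial vertex of $G$.
   Context: All graphs are finite and simple. For a digraph $D$, its competition graph $C(D)$ has vertex set $V(D)$, two distinct vertices $u,v$ adjacent iff some vertex $x$ satisfies $(u,x),(v,x)\in A(D)$. The competition number $k(G)$ is the smallest nonnegative integer $k$ such that $G$ together with $k$ new isolated vertices is the competition graph of an acyclic digraph. For a positive integer $m$, $CP(m)$ is the complete multipartite graph with $m$ parts each of size two. A vertex-weighted graph $(H,f)$ is a graph $H$ with $f:V(H)\to\mathbb{Z}_{\ge0}$. The generalized line graph $L(H,f)$ is obtained from the disjoint union of the line graph $L(H)$ (vertex set $E(H)$, two distinct edges adjacent iff they share an endpoint) and the graphs $Q_v:=CP(f(v))$ for each $v$ with $f(v)>0$, by adding all edges between every vertex of $Q_v$ and every $e\in E(H)$ incident to $v$. $K_H(v)$ is the set of edges of $H$ incident to $v$. A vertex is simplicial if its neighborhood is a clique. -}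

module Defs where

open import Data.Fin using (Fin; _<_)
open import Data.Fin.Properties using (_≟_; any?)
open import Data.Nat using (ℕ; _≤_)
open import Data.Product using (Σ-syntax; _×_; _,_; proj₁; ∃-syntax)
open import Data.Sum using (_⊎_)
open import Data.Sum.Relation.Binary.Pointwise using (Pointwise; inj₁; ⊎-decidable; ⊎-symmetric)
open import Function using (_∘_; _⇔_)
open import Level using (0ℓ)
open import Relation.Binary using (Rel; Decidable; Symmetric; Irreflexive; DecidableEquality)
open import Relation.Binary.Construct.Closure.ReflexiveTransitive using (Star)
open import Relation.Binary.Construct.Closure.Transitive using (TransClosure)
open import Relation.Binary.Construct.Never using (Never)
open import Relation.Binary.PropositionalEquality using (_≡_; _≢_; refl; sym; cong)
open import Relation.Nullary using (¬_; yes; no)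
open import Relation.Nullary.Decidable using (_×-dec_; _⊎-dec_; ¬?; map′)
open import Relation.Unary using (Pred; _∈_)

-- Simple graphs on a vertex type V.  V is finite wherever these are used.
-- For a finite graph, decidability of adjacency is no restriction classically.
record Graph (V : Set) : Set₁ where
  field
    Adj    : Rel V 0ℓ
    adj?   : Decidable Adj
    symm   : Symmetric Adj
    irrefl : Irreflexive _≡_ Adj

open Graph public

Connected : {V : Set} → Graph V → Set
Connected G = ∀ u v → Star (Adj G) u v

IsClique : {V : Set} → Graph V → Pred V 0ℓ → Set
IsClique G S = ∀ u v → u ∈ S → v ∈ S → u ≢ v → Adj G u v

Simplicial : {V : Set} → Graph V → V → Set
Simplicial G v = IsClique G (Adj G v)

record Digraph (V : Set) : Set₁ where
  field
    Arc  : Rel V 0ℓ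
    arc? : Decidable Arc

open Digraph public

Acyclic : {V : Set} → Digraph V → Set
Acyclic D = ∀ v → ¬ TransClosure (Arc D) v v

CompetitionAdj : {V : Set} → Digraph V → Rel V 0ℓ
CompetitionAdj D u v = u ≢ v × (∃[ x ] (Arc D u x × Arc D v x))

-- G equals the competition graph of D, as graphs on the same vertex set.
_IsCompetitionGraphOf_ : {V : Set} → Graph V → Digraph V → Set
G IsCompetitionGraphOf D = ∀ u v → Adj G u v ⇔ CompetitionAdj D u v

addIsolated : {V : Set} → Graph V → (k : ℕ) → Graph (V ⊎ Fin k)
addIsolated G k .Adj  = Pointwise (Adj G) Never
addIsolated G k .adj? = ⊎-decidable (adj? G) (λ _ _ → no λ ())
addIsolated G k .symm = ⊎-symmetric (symm G) (λ ())
addIsolated G k .irrefl refl (inj₁ a) = irrefl G refl a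

Realizable : {V : Set} → Graph V → ℕ → Set₁
Realizable {V} G k =
  Σ[ D ∈ Digraph (V ⊎ Fin k) ] Acyclic D × addIsolated G k IsCompetitionGraphOf D

-- The assertion that the competition number of G is k.
IsCompetitionNumber : {V : Set} → Graph V → ℕ → Set₁
IsCompetitionNumber G k = Realizable G k × (∀ j → Realizable G j → k ≤ j)

-- The unordered pair {src , tgt} is listed with its smaller element first.
-- The proof fields are irrelevant, so two edges are equal exactly when
-- their endpoints are.
record Edge {n : ℕ} (H : Graph (Fin n)) : Set where
  constructor edge
  field
    src tgt  : Fin n
    .ordered : src < tgt
    .joined  : Adj H src tgt

open Edge public

K : {n : ℕ} (H : Graph (Fin n)) → Fin n → Pred (Edge H) 0ℓ
K H v e = v ≡ src e ⊎ v ≡ tgt e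

K? : {n : ℕ} (H : Graph (Fin n)) → Decidable (K H)
K? H v e = (v ≟ src e) ⊎-dec (v ≟ tgt e)

_≟ᴱ_ : {n : ℕ} {H : Graph (Fin n)} → DecidableEquality (Edge H)
edge a b _ _ ≟ᴱ edge c d _ _ =
  map′ (λ { (refl , refl) → refl }) (λ { refl → refl , refl }) ((a ≟ c) ×-dec (b ≟ d))

lineGraph : {n : ℕ} (H : Graph (Fin n)) → Graph (Edge H)
lineGraph H .Adj e e′ = e ≢ e′ × (∃[ v ] (e ∈ K H v × e′ ∈ K H v))
lineGraph H .adj? e e′ = ¬? (e ≟ᴱ e′) ×-dec any? (λ v → K? H v e ×-dec K? H v e′)
lineGraph H .symm (e≢e′ , v , p , q) = (e≢e′ ∘ sym) , v , q , p
lineGraph H .irrefl e≡e′ (e≢e′ , _) = e≢e′ e≡e′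

-- (i , j) is the j-th vertex of the i-th part.
CP : (m : ℕ) → Graph (Fin m × Fin 2)
CP m .Adj (i , _) (i′ , _) = i ≢ i′
CP m .adj? (i , _) (i′ , _) = ¬? (i ≟ i′)
CP m .symm i≢i′ = i≢i′ ∘ sym
CP m .irrefl p≡q i≢i′ = i≢i′ (cong proj₁ p≡q)

module _ {n : ℕ} (H : Graph (Fin n)) (f : Fin n → ℕ) where

  -- When f v = 0 there are no vertices of the form inQ v p.
  data GLVertex : Set where
    inL : Edge H → GLVertex
    inQ : (v : Fin n) → Fin (f v) × Fin 2 → GLVertex

  data GLAdj : Rel GLVertex 0ℓ where
    L-L : ∀ {e e′} → Adj (lineGraph H) e e′ → GLAdj (inL e) (inL e′)
    Q-Q : ∀ {v p q} → Adj (CP (f v)) p q → GLAdj (inQ v p) (inQ v q)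
    L-Q : ∀ {e v p} → e ∈ K H v → GLAdj (inL e) (inQ v p)
    Q-L : ∀ {e v p} → e ∈ K H v → GLAdj (inQ v p) (inL e)

  generalizedLineGraph : Graph GLVertex
  generalizedLineGraph .Adj = GLAdj
  generalizedLineGraph .adj? (inL e) (inL e′) =
    map′ L-L (λ { (L-L a) → a }) (adj? (lineGraph H) e e′)
  generalizedLineGraph .adj? (inL e) (inQ v p) = map′ L-Q (λ { (L-Q a) → a }) (K? H v e)
  generalizedLineGraph .adj? (inQ v p) (inL e) = map′ Q-L (λ { (Q-L a) → a }) (K? H v e)
  generalizedLineGraph .adj? (inQ v p) (inQ w q) with v ≟ w
  ... | yes refl = map′ Q-Q (λ { (Q-Q a) → a }) (adj? (CP (f v)) p q)
  ... | no v≢w   = no λ { (Q-Q _) → v≢w refl }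
  generalizedLineGraph .symm (L-L a) = L-L (symm (lineGraph H) a)
  generalizedLineGraph .symm (Q-Q {v} {p} {q} a) = Q-Q (symm (CP (f v)) {p} {q} a)
  generalizedLineGraph .symm (L-Q a) = Q-L a
  generalizedLineGraph .symm (Q-L a) = L-Q a
  generalizedLineGraph .irrefl refl (L-L a) = irrefl (lineGraph H) refl a
  generalizedLineGraph .irrefl refl (Q-Q {v} {p} a) = irrefl (CP (f v)) {p} refl a

{-# OPTIONS --safe #-}

-- In an acyclic digraph D realising G with one extra vertex z, some vertex x
-- of G has no prey in G.  Then z is the only possible prey of x, so all
-- neighbours of x compete for z and x is simplicial.  A vertex adjacent to both
-- vertices of a part of some CP(m) is not simplicial, hence x either lies in some
-- CP(1) or is an edge of H whose endpoints both have weight zero.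
module Submission where

open import Defs
open import Data.Fin using (Fin; zero; suc; fromℕ<; _<?_)
open import Data.Fin.Induction using (spo-noetherian)
open import Data.Fin.Properties using (¬∀⟶∃¬)
open import Data.List using (List; []; _∷_; _++_; allFin; cartesianProduct; concatMap; length; lookup; map)
open import Data.List.Membership.Propositional using () renaming (_∈_ to _∈ᴸ_)
open import Data.List.Membership.Propositional.Properties
  using (∈-allFin; ∈-cartesianProduct⁺; ∈-concatMap⁺; ∈-map⁺; ∈-++⁺ˡ; ∈-++⁺ʳ)
open import Data.List.Relation.Unary.Any using (here; index; any?) renaming (map to Any-map)
open import Data.List.Relation.Unary.Any.Properties using (lookup-index)
open import Data.List.Relation.Unary.Enumerates.Setoid using (IsEnumeration)
open import Data.Nat using (ℕ; zero; suc)
import Data.Nat.Properties as ℕ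
open import Data.Product using (_×_; _,_; ∃-syntax)
open import Data.Sum using (_⊎_; inj₁; inj₂)
open import Data.Sum.Relation.Binary.Pointwise using (inj₁)
open import Function using (_∘_; flip; Equivalence)
open import Induction.WellFounded using (Acc; acc)
open import Level using (0ℓ)
open import Relation.Binary using (Rel; Decidable; IsStrictPartialOrder)
open import Relation.Binary.Construct.Closure.Transitive as Closure using (TransClosure; [_]; _∷_)
open import Relation.Binary.PropositionalEquality using (_≡_; _≢_; refl; setoid; isEquivalence)
open import Relation.Nullary using (¬_; yes; no; contradiction)
open import Relation.Nullary.Negation.Core using (contradiction-irr)
open import Relation.Unary using (_∈_)

module _ {A : Set} {R : Rel A 0ℓ} (R? : Decidable R) (acyclic : ∀ x → ¬ TransClosure R x x)
         {xs : List A} (enum : IsEnumeration (setoid A) xs) where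

  private
    -- Reachability is carried over to positions in the enumeration, since every strict partial
    -- order on `Fin` is Noetherian. Repeated entries of `xs` do no harm: positions holding the same
    -- vertex are incomparable by acyclicity.
    _⊏_ : Rel (Fin (length xs)) 0ℓ
    i ⊏ j = TransClosure R (lookup xs i) (lookup xs j)

    isSPO : IsStrictPartialOrder _≡_ _⊏_
    isSPO = record
      { isEquivalence = isEquivalence
      ; irrefl        = λ { refl → acyclic _ }
      ; trans         = Closure._++_
      ; <-resp-≈      = (λ { refl p → p }) , (λ { refl p → p })
      }

    -- Follow arcs for as long as one leaves the current vertex. Each move goes up in `_⊏_`, so
    -- accessibility for the flipped order ends the walk.
    sinkAbove : ∀ i → Acc (flip _⊏_) i → ∃[ x ] (∀ y → ¬ R x y)
    sinkAbove i (acc above) with any? (R? (lookup xs i)) xs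
    ... | yes r = sinkAbove (index r) (above [ lookup-index r ])
    ... | no ¬r = lookup xs i , λ y r → ¬r (Any-map (λ { refl → r }) (enum y))

  acyclic⇒sink : A → ∃[ x ] (∀ y → ¬ R x y)
  acyclic⇒sink a = sinkAbove (index (enum a)) (spo-noetherian isSPO _)

edgesBetween : ∀ {n} (H : Graph (Fin n)) → Fin n × Fin n → List (Edge H)
edgesBetween H (a , b) with a <? b | adj? H a b
... | yes a<b | yes ab = edge a b a<b ab ∷ []
... | yes _   | no _   = []
... | no _    | _      = []

-- The proofs produced by the decision procedures need not be those stored in the edge; `refl` still
-- works because both fields are irrelevant.
∈-edgesBetween : ∀ {n} (H : Graph (Fin n)) (e : Edge H) → e ∈ᴸ edgesBetween H (src e , tgt e)
∈-edgesBetween H (edge a b a<b ab) with a <? b | adj? H a b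
... | yes _  | yes _  = here refl
... | yes _  | no ¬ab = contradiction-irr ab ¬ab
... | no a≮b | _      = contradiction-irr a<b a≮b

allPairs : ∀ m n → List (Fin m × Fin n)
allPairs m n = cartesianProduct (allFin m) (allFin n)

allPairs-enum : ∀ m n → IsEnumeration (setoid _) (allPairs m n)
allPairs-enum m n (i , j) = ∈-cartesianProduct⁺ (∈-allFin i) (∈-allFin j)

∈-concatMap : ∀ {A B : Set} (g : A → List B) {xs x y} → x ∈ᴸ xs → y ∈ᴸ g x → y ∈ᴸ concatMap g xs
∈-concatMap g x∈xs y∈gx = ∈-concatMap⁺ g (Any-map (λ { refl → y∈gx }) x∈xs)

module _ {n : ℕ} (H : Graph (Fin n)) (f : Fin n → ℕ) where

  private
    G : Graph (GLVertex H f)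
    G = generalizedLineGraph H f

    verticesQ : Fin n → List (GLVertex H f)
    verticesQ v = map (inQ v) (allPairs (f v) 2)

    verticesL : List (GLVertex H f)
    verticesL = map inL (concatMap (edgesBetween H) (allPairs n n))

  vertices : List (GLVertex H f)
  vertices = verticesL ++ concatMap verticesQ (allFin n)

  vertices-enum : IsEnumeration (setoid _) vertices
  vertices-enum (inL e) =
    ∈-++⁺ˡ (∈-map⁺ inL (∈-concatMap (edgesBetween H) (allPairs-enum n n _) (∈-edgesBetween H e)))
  vertices-enum (inQ v p) =
    ∈-++⁺ʳ verticesL (∈-concatMap verticesQ (∈-allFin v) (∈-map⁺ (inQ v) (allPairs-enum (f v) 2 p)))

  -- The two vertices of a part are distinct and nonadjacent, so they cannot both lie in a
  -- neighbourhood that is a clique.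
  simplicial-parts : ∀ {x v} → Simplicial G x → (i : Fin (f v)) →
    ¬ (∀ j → Adj G x (inQ v (i , j)))
  simplicial-parts s i adj with s _ _ (adj zero) (adj (suc zero)) (λ ())
  ... | Q-Q i≢i = i≢i refl

  simplicial-inQ : ∀ {v p} → Simplicial G (inQ v p) → f v ≡ 1
  -- Any second part `j` would consist entirely of neighbours of the vertex.
  simplicial-inQ {v} {i , _} s = Fin-unique (f v) i λ j i≢j → simplicial-parts s j λ _ → Q-Q i≢j
    where
    Fin-unique : ∀ m (i : Fin m) → (∀ j → ¬ i ≢ j) → m ≡ 1
    Fin-unique (suc zero)    _       _   = refl
    Fin-unique (suc (suc _)) zero    all = contradiction (λ ()) (all (suc zero))
    Fin-unique (suc (suc _)) (suc _) all = contradiction (λ ()) (all zero)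

  -- An edge incident to `v` is joined to all of `Q_v`, so even a single part is excluded.
  simplicial-inL : ∀ {e v} → e ∈ K H v → Simplicial G (inL e) → f v ≡ 0
  simplicial-inL {v = v} e∈K s = Fin-empty (f v) λ i → simplicial-parts s i λ _ → L-Q e∈K
    where
    Fin-empty : ∀ m → ¬ Fin m → m ≡ 0
    Fin-empty zero    _     = refl
    Fin-empty (suc _) empty = contradiction zero empty

realizable₁⇒simplicial : ∀ {V : Set} {G : Graph V} {xs} → IsEnumeration (setoid V) xs →
  V → Realizable G 1 → ∃[ x ] Simplicial G x
realizable₁⇒simplicial {V} {G} enum a (D , acyclic , competition) =
  -- The sink is sought among the old vertices only: a sink of all of `D` could be the new vertex.
  let x , sink = acyclic⇒sink (λ u v → arc? D (inj₁ u) (inj₁ v))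
                   (λ v → acyclic (inj₁ v) ∘ embed) enum a
  in x , λ u v xu xv u≢v → unlift (Equivalence.from (competition _ _)
       ((λ { refl → u≢v refl }) , inj₂ zero , preysOnNew sink xu , preysOnNew sink xv))
  where
  embed : ∀ {u v} → TransClosure (λ u v → Arc D (inj₁ u) (inj₁ v)) u v →
          TransClosure (Arc D) (inj₁ u) (inj₁ v)
  embed [ r ]    = [ r ]
  embed (r ∷ rs) = r ∷ embed rs

  unlift : ∀ {u v} → Adj (addIsolated G 1) (inj₁ u) (inj₁ v) → Adj G u v
  unlift (inj₁ uv) = uv

  -- Adjacency gives `x` and `u` a common prey; it is not an old vertex, so it is the new one.
  preysOnNew : ∀ {x u} → (∀ y → ¬ Arc D (inj₁ x) (inj₁ y)) → Adj G x u →
               Arc D (inj₁ u) (inj₂ zero)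
  preysOnNew sink xu with Equivalence.to (competition _ _) (inj₁ xu)
  ... | _ , inj₁ y    , xy , _  = contradiction xy (sink y)
  ... | _ , inj₂ zero , _  , uz = uz

theorem2p8 : (n : ℕ) (H : Graph (Fin n)) (f : Fin n → ℕ) →
    Connected H → ¬ (∀ v → f v ≡ 0) →
    IsCompetitionNumber (generalizedLineGraph H f) 1 →
    (∃[ v ] (f v ≡ 1)) ⊎
    (∃[ v ] (f v ≡ 0 × (∃[ e ] (e ∈ K H v × Simplicial (generalizedLineGraph H f) (inL e)))))
theorem2p8 n H f _ f≢0 (realizable , _)
  -- A vertex of nonzero weight makes `G` nonempty, which the search for a sink needs as its
  -- starting point.
  with w , fw≢0 ← ¬∀⟶∃¬ n _ (λ v → f v ℕ.≟ 0) f≢0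
  with realizable₁⇒simplicial {G = generalizedLineGraph H f} (vertices-enum H f)
         (inQ w (fromℕ< (ℕ.n≢0⇒n>0 fw≢0) , zero)) realizable
... | inQ v p , s = inj₁ (v , simplicial-inQ H f s)
-- Both endpoints of `e` have weight zero; `src e` is an arbitrary choice between them.
... | inL e   , s = inj₂ (src e , simplicial-inL H f (inj₁ refl) s , e , inj₁ refl , s)
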